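{- Let $n$ and $k$ be integers with $1\le k\le n$. Let $f(x)$ be a nonzero polynomial with nonnegative integer coefficients, and let $\vec{s}=(s_1,\dots,s_k)$ be a $k$-tuple of positive integers such that either $\deg f(x)\ge 2$, or $f(x)$ is linear and $s_j\ge 2$ for all integers $j$ with $1\le j\le k$. Then $H_{k,f}(\vec{s},n)$ and $H^*_{k,f}(\vec{s},n)$ are not integers, except in the case where $f(x)=x^m$ for some integer $m\ge 1$ and $n=k=1$; in that exceptional case both $H_{k,f}(\vec{s},n)$ and $H^*_{k,f}(\vec{s},n)$ are integers.
   Context: For integers $1\le k\le n$, a polynomial $f(x)$ with integer coefficients such that $f(m)\neq 0$ for every positive integer $m$, and a $k$-tuple $\vec{s}=(s_1,\dots,s_k)$ of positive integers, define $$H_{k,f}(\vec{s},n)=\sum_{1\le i_1<\cdots<i_k\le n}\prod_{j=1}^k\frac{1}{f(i_j)^{s_j}},\qquad H^*_{k,f}(\vec{s},n)=\sum_{1\le i_1\le\cdots\le i_k\le n}\prod_{j=1}^k\frac{1}{f(i_j)^{s_j}}.$$ (A nonzero polynomial with nonnegative integer coefficients satisfies $f(m)>0$ for all positive integers $m$.) -}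

module Defs where

open import Data.Nat as ℕ using (ℕ; zero; suc; _∸_)
open import Data.Integer using (ℤ; +_)
open import Data.Rational as ℚ using (ℚ; 0ℚ; 1ℚ)
open import Data.List as List using (List; []; _∷_; upTo; map; foldr; replicate; _++_)
open import Data.Vec as Vec using (Vec)
open import Data.Bool using (Bool; true; false; _∧_; if_then_else_)
open import Data.Product using (∃-syntax)
open import Relation.Binary.PropositionalEquality using (_≡_; _≢_)

-- A polynomial with nonnegative integer coefficients, as its coefficient
-- list, constant term first: a₀ ∷ a₁ ∷ … represents a₀ + a₁ x + …
Poly : Set
Poly = List ℕ

coeff : Poly → ℕ → ℕ
coeff []       _       = 0
coeff (a ∷ as) zero    = a
coeff (a ∷ as) (suc i) = coeff as i

eval : Poly → ℕ → ℕ
eval []       x = 0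
eval (a ∷ as) x = a ℕ.+ x ℕ.* eval as x

isZeroPoly : Poly → Bool
isZeroPoly []           = true
isZeroPoly (zero ∷ as)  = isZeroPoly as
isZeroPoly (suc _ ∷ as) = false

NonZeroPoly : Poly → Set
NonZeroPoly f = ∃[ i ] (coeff f i ≢ 0)

-- degree (trailing zero coefficients are ignored; deg 0 = 0)
deg : Poly → ℕ
deg []       = 0
deg (a ∷ as) = if isZeroPoly as then 0 else suc (deg as)

monomial : ℕ → Poly
monomial m = replicate m 0 ++ (1 ∷ [])

_≈P_ : Poly → Poly → Set
f ≈P g = ∀ i → coeff f i ≡ coeff g i

-- 1 / d as a rational (d = 0 ↦ 0; never used when f(i) > 0)
inv : ℕ → ℚ
inv zero    = 0ℚ
inv (suc d) = + 1 ℚ./ suc d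

Σℚ : List ℚ → ℚ
Σℚ = foldr ℚ._+_ 0ℚ

range : ℕ → ℕ → List ℕ
range ℓ n = map (ℓ ℕ.+_) (upTo (suc n ∸ ℓ))

term : Poly → ℕ → ℕ → ℚ
term f s i = inv (eval f i ℕ.^ s)

-- Hs f n ss ℓ = Σ over ℓ ≤ i₁ < i₂ < ⋯ < i_k ≤ n of ∏ 1/f(i_j)^{s_j}
Hs : Poly → ℕ → List ℕ → ℕ → ℚ
Hs f n []       ℓ = 1ℚ
Hs f n (s ∷ ss) ℓ = Σℚ (map (λ i → term f s i ℚ.* Hs f n ss (suc i)) (range ℓ n))

-- Hw f n ss ℓ = Σ over ℓ ≤ i₁ ≤ i₂ ≤ ⋯ ≤ i_k ≤ n of ∏ 1/f(i_j)^{s_j}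
Hw : Poly → ℕ → List ℕ → ℕ → ℚ
Hw f n []       ℓ = 1ℚ
Hw f n (s ∷ ss) ℓ = Σℚ (map (λ i → term f s i ℚ.* Hw f n ss i) (range ℓ n))

H : (k : ℕ) → Poly → Vec ℕ k → ℕ → ℚ
H k f s n = Hs f n (Vec.toList s) 1

H* : (k : ℕ) → Poly → Vec ℕ k → ℕ → ℚ
H* k f s n = Hw f n (Vec.toList s) 1

IsInteger : ℚ → Set
IsInteger q = ∃[ z ] q ≡ z ℚ./ 1

{-# OPTIONS --safe #-}
module Submission where

-- Every term is at most 1/i², so all the sums are confined to short intervals.
-- Over i ≥ 2, weak chains of any lengths together contribute less than
-- ∏_{i ≥ 2} (1 − 1/i²)⁻¹ = 2, which gives H* < 2.
-- If f(1) = 1 and n ≥ 2, then 1 < H* < 2, while H = H* for k = 1 and 0 < H < 1 for k ≥ 2;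
-- n = 1 is the exceptional case.
-- If f(1) ≥ 2 and k ≥ 2, then 0 < H ≤ H* < 1.
-- If f(1) ≥ 2 and k = 1, then H = H* < 1 when f(x)^s ≥ x² + x or f(x)^s ≥ x² + 2 throughout; the only
-- other possibility is f(x)^s = x² + 1, whose partial sums pass from below 1 to above 1
-- between n = 12 and n = 13.

open import Defs
open import Data.Bool using (false)
open import Data.Fin using (zero; suc)
import Data.Integer as ℤ
import Data.Integer.Properties as ℤ
open import Data.List using (List; []; _∷_; length; map; upTo; applyUpTo)
open import Data.List.Properties using (map-applyUpTo; map-upTo; map-cong; map-∘)
open import Data.List.Relation.Unary.All using (All; []; _∷_)
open import Data.Nat as ℕ using (ℕ; zero; suc; z≤n; s≤s)
import Data.Nat.Properties as ℕ
open import Data.Nat.Tactic.RingSolver using (solve-∀)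
open import Data.Product using (_×_; _,_; ∃-syntax)
open import Data.Rational as ℚ using (ℚ; 0ℚ; 1ℚ; _/_; toℚᵘ; nonNegative; positive)
open import Data.Rational.Solver using (module +-*-Solver)
open import Data.Rational.Unnormalised as ℚᵘ using (mkℚᵘ)
import Data.Rational.Unnormalised.Properties as ℚᵘ
open import Data.Sum as Sum using (_⊎_; inj₁; inj₂; [_,_]′)
open import Data.Unit using (tt)
open import Data.Vec as Vec using (Vec; lookup)
open import Data.Vec.Properties using (length-toList)
open import Function using (_∘_)
open import Relation.Nullary using (¬_; yes; no)
open import Relation.Nullary.Decidable using (toWitness)
open import Relation.Binary.PropositionalEquality

-- Growth of polynomials with nonnegative integer coefficients.

module PolynomialGrowth where

  open import Data.Nat using (_+_; _*_; _^_; _≤_)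

  eval-cong : ∀ f g x → f ≈P g → eval f x ≡ eval g x
  eval-cong []       []       x f≈g = refl
  eval-cong []       (b ∷ bs) x f≈g =
    cong₂ _+_ (f≈g 0) (trans (sym (ℕ.*-zeroʳ x)) (cong (x *_) (eval-cong [] bs x (λ i → f≈g (suc i)))))
  eval-cong (a ∷ as) []       x f≈g =
    cong₂ _+_ (f≈g 0) (trans (cong (x *_) (eval-cong as [] x (λ i → f≈g (suc i)))) (ℕ.*-zeroʳ x))
  eval-cong (a ∷ as) (b ∷ bs) x f≈g =
    cong₂ (λ c v → c + x * v) (f≈g 0) (eval-cong as bs x (λ i → f≈g (suc i)))

  eval-monomial-1 : ∀ m → eval (monomial m) 1 ≡ 1
  eval-monomial-1 zero    = refl
  eval-monomial-1 (suc m) = trans (ℕ.+-identityʳ _) (eval-monomial-1 m)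

  eval-∷-1 : ∀ a p → eval (a ∷ p) 1 ≡ a + eval p 1
  eval-∷-1 a p = cong (a +_) (ℕ.*-identityˡ (eval p 1))

  eval-1≡0⇒coeff≡0 : ∀ p → eval p 1 ≡ 0 → p ≈P []
  eval-1≡0⇒coeff≡0 []          _  i       = refl
  eval-1≡0⇒coeff≡0 (zero ∷ p)  eq zero    = refl
  eval-1≡0⇒coeff≡0 (zero ∷ p)  eq (suc i) = eval-1≡0⇒coeff≡0 p (trans (sym (eval-∷-1 0 p)) eq) i

  -- The value at 1 is the sum of the coefficients, so among natural numbers the value 1 leaves room
  -- for a single coefficient 1 and zeros elsewhere.
  eval-1≡1⇒monomial : ∀ p → eval p 1 ≡ 1 → ∃[ m ] p ≈P monomial m
  eval-1≡1⇒monomial (zero ∷ p) eq with m , p≈ ← eval-1≡1⇒monomial p (trans (sym (eval-∷-1 0 p)) eq) =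
    suc m , λ { zero → refl ; (suc i) → p≈ i }
  eval-1≡1⇒monomial (suc zero ∷ p) eq =
    0 , λ { zero → refl ; (suc i) → eval-1≡0⇒coeff≡0 p (ℕ.suc-injective (trans (sym (eval-∷-1 1 p)) eq)) i }

  eval≥1 : ∀ p x → isZeroPoly p ≡ false → 1 ≤ eval p (suc x)
  eval≥1 (zero ∷ p)  x nz = ℕ.*-mono-≤ {1} {suc x} (s≤s z≤n) (eval≥1 p x nz)
  eval≥1 (suc a ∷ p) x nz = s≤s z≤n

  eval-1≤ : ∀ p x → eval p 1 ≤ eval p (suc x)
  eval-1≤ []      x = z≤n
  eval-1≤ (a ∷ p) x = ℕ.+-monoʳ-≤ a (ℕ.*-mono-≤ {1} {suc x} {eval p 1} (s≤s z≤n) (eval-1≤ p x))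

  deg-∷⁻ : ∀ {d} a p → suc d ≤ deg (a ∷ p) → isZeroPoly p ≡ false × d ≤ deg p
  deg-∷⁻ a p le with isZeroPoly p
  deg-∷⁻ a p (s≤s le) | false = refl , le

  isZeroPoly≡false : ∀ p → 1 ≤ deg p → isZeroPoly p ≡ false
  isZeroPoly≡false (zero ∷ p)  le with nz , _ ← deg-∷⁻ 0 p le = nz
  isZeroPoly≡false (suc a ∷ p) le = refl

  power≤eval : ∀ d p x → isZeroPoly p ≡ false → d ≤ deg p → suc x ^ d ≤ eval p (suc x)
  power≤eval zero    p       x nz le = eval≥1 p x nz
  power≤eval (suc d) (a ∷ p) x _  le with nz , le′ ← deg-∷⁻ a p le =
    ℕ.≤-trans (ℕ.*-monoʳ-≤ (suc x) (power≤eval d p x nz le′)) (ℕ.m≤n+m _ a)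

  -- With zero constant term, p = x g and g(x) ≥ g(1) ≥ 2, so p(x) ≥ 2x ≥ x + 1 at every positive x.
  -- Otherwise the nonconstant part gives at least x and the constant term at least 1.
  eval≥x+1 : ∀ p x → 1 ≤ deg p → 2 ≤ eval p 1 → suc (suc x) ≤ eval p (suc x)
  eval≥x+1 (zero ∷ p) x le two with nz , _ ← deg-∷⁻ 0 p le = begin
    suc (suc x)              ≤⟨ ℕ.m≤m+n _ x ⟩
    suc (suc x) + x          ≡⟨ lem x ⟩
    suc x * 2                ≤⟨ ℕ.*-monoʳ-≤ (suc x) (ℕ.≤-trans two (ℕ.≤-trans (ℕ.≤-reflexive (eval-∷-1 0 p)) (eval-1≤ p x))) ⟩
    suc x * eval p (suc x)   ∎
    where
    open ℕ.≤-Reasoning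
    lem : ∀ x → suc (suc x) + x ≡ suc x * 2
    lem = solve-∀
  eval≥x+1 (suc a ∷ p) x le two with nz , _ ← deg-∷⁻ (suc a) p le = begin
    1 + suc x                      ≡⟨ cong suc (ℕ.*-identityʳ (suc x)) ⟨
    1 + suc x * 1                  ≤⟨ ℕ.+-mono-≤ {1} {suc a} (s≤s z≤n) (ℕ.*-monoʳ-≤ (suc x) (eval≥1 p x nz)) ⟩
    suc a + suc x * eval p (suc x) ∎
    where open ℕ.≤-Reasoning

  -- The reciprocals of x² + x and of x² + 2 have sums at most 1 over all positive x, so lower
  -- bounds on `v` suffice there. The reciprocals of x² + 1 eventually sum to more than 1, so that
  -- case records the exact values.
  data Growth (v : ℕ → ℕ) : Set where
    ≥x²+x : (∀ x → suc x * suc x + suc x ≤ v (suc x)) → Growth v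
    ≥x²+2 : (∀ x → suc x * suc x + 2 ≤ v (suc x)) → Growth v
    ≡x²+1 : (∀ x → v (suc x) ≡ suc x * suc x + 1) → Growth v

  x[1+x]≡x²+x : ∀ x → suc x * suc (suc x) ≡ suc x * suc x + suc x
  x[1+x]≡x²+x = solve-∀

  -- Write f = a + x g. If a = 0, then g(1) = f(1) ≥ 2, and g(1) ≥ 2 always gives g(x) ≥ x + 1,
  -- hence x² + x. If a ≥ 2, then g(x) ≥ x gives x² + 2. What remains is a = 1 and g(1) = 1, where g
  -- is a monomial: g = x gives x² + 1, a higher exponent gives at least x³ + 1.
  eval-growth : ∀ f → 2 ≤ deg f → 2 ≤ eval f 1 → Growth (eval f)
  eval-growth (a ∷ g) le two with nz , le′ ← deg-∷⁻ a g le = by-constant a two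
    where
    open ℕ.≤-Reasoning

    large : ∀ a → 2 ≤ eval g 1 → Growth (eval (a ∷ g))
    large a two′ = ≥x²+x λ x → begin
      suc x * suc x + suc x        ≡⟨ x[1+x]≡x²+x x ⟨
      suc x * suc (suc x)          ≤⟨ ℕ.*-monoʳ-≤ (suc x) (eval≥x+1 g x le′ two′) ⟩
      suc x * eval g (suc x)       ≤⟨ ℕ.m≤n+m _ a ⟩
      a + suc x * eval g (suc x)   ∎

    small : ∀ g → 1 ≤ deg g → eval g 1 ≡ 1 → Growth (eval (1 ∷ g))
    -- Here f = 1 + x³ h with h ≥ 1, and 1 + x³ = (x² + x) + (x - 1)²(x + 1). The last product is
    -- the slack below, with x shifted by one.
    small (zero ∷ (zero ∷ h)) le eq = ≥x²+x λ x → begin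
      suc x * suc x + suc x                            ≤⟨ ℕ.m≤m+n _ (x * x * (2 + x)) ⟩
      suc x * suc x + suc x + x * x * (2 + x)          ≡⟨ lem x ⟩
      1 + suc x * (suc x * (suc x * 1))
        ≤⟨ ℕ.+-monoʳ-≤ 1 (ℕ.*-monoʳ-≤ (suc x) (ℕ.*-monoʳ-≤ (suc x) (ℕ.*-monoʳ-≤ (suc x) (h≥1 x)))) ⟩
      1 + suc x * (suc x * (suc x * eval h (suc x)))   ∎
      where
      lem : ∀ x → suc x * suc x + suc x + x * x * (2 + x) ≡ 1 + suc x * (suc x * (suc x * 1))
      lem = solve-∀
      h≥1 : ∀ x → 1 ≤ eval h (suc x)
      h≥1 x = ℕ.≤-trans
        (ℕ.≤-reflexive (sym (trans (sym (trans (eval-∷-1 0 (0 ∷ h)) (eval-∷-1 0 h))) eq))) (eval-1≤ h x)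
    -- The coefficient `suc b` already exhausts g(1) = 1, so b = 0, h vanishes and g = x.
    small (zero ∷ (suc b ∷ h)) le eq = ≡x²+1 λ x →
      trans (cong₂ (λ c v → 1 + suc x * (suc x * (suc c + suc x * v))) b≡0
               (eval-cong h [] (suc x) (eval-1≡0⇒coeff≡0 h h1≡0)))
            (lem x)
      where
      sum≡0 : b + eval h 1 ≡ 0
      sum≡0 = ℕ.suc-injective (trans (sym (trans (eval-∷-1 0 (suc b ∷ h)) (eval-∷-1 (suc b) h))) eq)
      b≡0 : b ≡ 0
      b≡0 = ℕ.m+n≡0⇒m≡0 b sum≡0
      h1≡0 : eval h 1 ≡ 0
      h1≡0 = ℕ.m+n≡0⇒n≡0 b sum≡0
      lem : ∀ x → 1 + suc x * (suc x * (1 + suc x * 0)) ≡ suc x * suc x + 1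
      lem = solve-∀
    -- Impossible: g(1) = 1 would force h(1) = 0, but g is not constant, so h is nonzero.
    small (suc b ∷ h) le eq with nz , _ ← deg-∷⁻ (suc b) h le
      with () ← ℕ.≤-trans (eval≥1 h 0 nz) (ℕ.≤-reflexive (ℕ.m+n≡0⇒n≡0 b
        (ℕ.suc-injective (trans (sym (eval-∷-1 (suc b) h)) eq))))

    by-constant : ∀ a → 2 ≤ eval (a ∷ g) 1 → Growth (eval (a ∷ g))
    by-constant zero          two = large 0 (ℕ.≤-trans two (ℕ.≤-reflexive (eval-∷-1 0 g)))
    by-constant (suc zero)    two with ℕ.m≤n⇒m<n∨m≡n (eval≥1 g 0 nz)
    ... | inj₁ two′ = large 1 two′
    ... | inj₂ one  = small g le′ (sym one)
    by-constant (suc (suc a)) two = ≥x²+2 λ x → begin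
      suc x * suc x + 2                     ≡⟨ ℕ.+-comm _ 2 ⟩
      2 + suc x * suc x                     ≤⟨ ℕ.+-mono-≤ (ℕ.m≤m+n 2 a) (ℕ.*-monoʳ-≤ (suc x)
                                                 (ℕ.≤-trans (ℕ.≤-reflexive (sym (ℕ.*-identityʳ (suc x)))) (power≤eval 1 g x nz le′))) ⟩
      suc (suc a) + suc x * eval g (suc x)  ∎

  v≤v^s : ∀ v s → 1 ≤ v → 1 ≤ s → v ≤ v ^ s
  v≤v^s v s v≥1 s≥1 = ℕ.≤-trans (ℕ.≤-reflexive (sym (ℕ.^-identityʳ v))) (ℕ.^-monoʳ-≤ v ⦃ ℕ.>-nonZero v≥1 ⦄ s≥1)

  v*v≤v^s : ∀ v s → 1 ≤ v → 2 ≤ s → v * v ≤ v ^ s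
  v*v≤v^s v s v≥1 s≥2 =
    ℕ.≤-trans (ℕ.≤-reflexive (cong (v *_) (sym (ℕ.*-identityʳ v)))) (ℕ.^-monoʳ-≤ v ⦃ ℕ.>-nonZero v≥1 ⦄ s≥2)

  Admissible : Poly → ℕ → Set
  Admissible f s = (2 ≤ deg f × 1 ≤ s) ⊎ (deg f ≡ 1 × 2 ≤ s)

  -- The square comes from the degree when `deg f` is at least 2, and from the exponent when f is
  -- linear, where f(x) ≥ x.
  square≤eval^ : ∀ f s → Admissible f s → ∀ x → suc x * suc x ≤ eval f (suc x) ^ s
  square≤eval^ f s (inj₁ (le , s≥1)) x =
    ℕ.≤-trans (ℕ.≤-trans (ℕ.≤-reflexive (cong (suc x *_) (sym (ℕ.*-identityʳ (suc x))))) (power≤eval 2 f x nz le))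
              (v≤v^s _ s (eval≥1 f x nz) s≥1)
    where nz = isZeroPoly≡false f (ℕ.≤-trans (s≤s z≤n) le)
  square≤eval^ f s (inj₂ (d≡1 , s≥2)) x =
    ℕ.≤-trans (ℕ.*-mono-≤ x≤v x≤v) (v*v≤v^s _ s (eval≥1 f x nz) s≥2)
    where
    nz = isZeroPoly≡false f (ℕ.≤-reflexive (sym d≡1))
    x≤v = ℕ.≤-trans (ℕ.≤-reflexive (sym (ℕ.*-identityʳ (suc x)))) (power≤eval 1 f x nz (ℕ.≤-reflexive (sym d≡1)))

  -- For degree at least 2, raising to a power keeps the two lower bounds, and x² + 1 survives only
  -- for s = 1, since its square exceeds x² + x. For linear f with f(1) ≥ 2, f(x)² ≥ x(x + 1).
  eval^-growth : ∀ f s → Admissible f s → 2 ≤ eval f 1 → Growth (λ x → eval f x ^ s)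
  eval^-growth f s (inj₁ (le , s≥1)) two with eval-growth f le two
  ... | ≥x²+x h = ≥x²+x λ x → ℕ.≤-trans (h x) (v≤v^s _ s (ℕ.≤-trans (s≤s z≤n) (h x)) s≥1)
  ... | ≥x²+2 h = ≥x²+2 λ x → ℕ.≤-trans (h x) (v≤v^s _ s (ℕ.≤-trans (s≤s z≤n) (h x)) s≥1)
  ... | ≡x²+1 h with ℕ.m≤n⇒m<n∨m≡n s≥1
  ...   | inj₂ refl = ≡x²+1 λ x → trans (ℕ.^-identityʳ _) (h x)
  ...   | inj₁ s≥2  = ≥x²+x λ x → begin
      suc x * suc x + suc x                                 ≤⟨ ℕ.m≤m+n _ (suc x * suc x * suc x * suc x + suc x * x + 1) ⟩
      suc x * suc x + suc x + (suc x * suc x * suc x * suc x + suc x * x + 1) ≡⟨ lem x ⟩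
      (suc x * suc x + 1) * (suc x * suc x + 1)             ≡⟨ cong₂ _*_ (h x) (h x) ⟨
      eval f (suc x) * eval f (suc x)
        ≤⟨ v*v≤v^s _ s (ℕ.≤-trans (s≤s z≤n) (ℕ.≤-reflexive (sym (h x)))) s≥2 ⟩
      eval f (suc x) ^ s                                    ∎
      where
      open ℕ.≤-Reasoning
      lem : ∀ x → suc x * suc x + suc x + (suc x * suc x * suc x * suc x + suc x * x + 1) ≡ (suc x * suc x + 1) * (suc x * suc x + 1)
      lem = solve-∀
  eval^-growth f s (inj₂ (d≡1 , s≥2)) two = ≥x²+x λ x → let v≥ = eval≥x+1 f x (ℕ.≤-reflexive (sym d≡1)) two in begin
      suc x * suc x + suc x            ≡⟨ x[1+x]≡x²+x x ⟨
      suc x * suc (suc x)              ≤⟨ ℕ.*-mono-≤ (ℕ.≤-trans (ℕ.n≤1+n _) v≥) v≥ ⟩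
      eval f (suc x) * eval f (suc x)  ≤⟨ v*v≤v^s _ s (ℕ.≤-trans (s≤s z≤n) v≥) s≥2 ⟩
      eval f (suc x) ^ s               ∎
      where open ℕ.≤-Reasoning

module SumBounds where

  open PolynomialGrowth
  open import Data.Integer using (+_)
  open import Data.Rational using (_+_; _*_; _≤_; _<_)
  open import Data.Rational.Properties

  -- Fractions of natural numbers: comparison by cross-multiplication, sums and products.

  toℚᵘ-/ : ∀ p q → toℚᵘ (+ p / suc q) ℚᵘ.≃ mkℚᵘ (+ p) q
  toℚᵘ-/ p q = toℚᵘ-fromℚᵘ (mkℚᵘ (+ p) q)

  /-mono-≤ : ∀ p q p′ q′ .⦃ _ : ℕ.NonZero q ⦄ .⦃ _ : ℕ.NonZero q′ ⦄ →
             p ℕ.* q′ ℕ.≤ p′ ℕ.* q → + p / q ≤ + p′ / q′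
  /-mono-≤ p (suc q) p′ (suc q′) le = toℚᵘ-cancel-≤ (ℚᵘ.≤-respˡ-≃ (ℚᵘ.≃-sym (toℚᵘ-/ p q))
    (ℚᵘ.≤-respʳ-≃ (ℚᵘ.≃-sym (toℚᵘ-/ p′ q′))
      (ℚᵘ.*≤* (subst₂ ℤ._≤_ (ℤ.pos-* p (suc q′)) (ℤ.pos-* p′ (suc q)) (ℤ.+≤+ le)))))

  /-mono-< : ∀ p q p′ q′ .⦃ _ : ℕ.NonZero q ⦄ .⦃ _ : ℕ.NonZero q′ ⦄ →
             p ℕ.* q′ ℕ.< p′ ℕ.* q → + p / q < + p′ / q′
  /-mono-< p (suc q) p′ (suc q′) lt = toℚᵘ-cancel-< (ℚᵘ.<-respˡ-≃ (ℚᵘ.≃-sym (toℚᵘ-/ p q))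
    (ℚᵘ.<-respʳ-≃ (ℚᵘ.≃-sym (toℚᵘ-/ p′ q′))
      (ℚᵘ.*<* (subst₂ ℤ._<_ (ℤ.pos-* p (suc q′)) (ℤ.pos-* p′ (suc q)) (ℤ.+<+ lt)))))

  /-homo-+ : ∀ p q p′ q′ → + p / suc q + + p′ / suc q′ ≡ + (p ℕ.* suc q′ ℕ.+ p′ ℕ.* suc q) / (suc q ℕ.* suc q′)
  /-homo-+ p q p′ q′ = toℚᵘ-injective (ℚᵘ.≃-trans (toℚᵘ-homo-+ (+ p / suc q) (+ p′ / suc q′))
    (ℚᵘ.≃-trans (ℚᵘ.+-cong (toℚᵘ-/ p q) (toℚᵘ-/ p′ q′))
    (ℚᵘ.≃-trans (ℚᵘ.≃-reflexive (cong (λ z → mkℚᵘ z (ℕ.pred (suc q ℕ.* suc q′))) num))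
      (ℚᵘ.≃-sym (toℚᵘ-/ (p ℕ.* suc q′ ℕ.+ p′ ℕ.* suc q) (ℕ.pred (suc q ℕ.* suc q′)))))))
    where
    num : + p ℤ.* + suc q′ ℤ.+ + p′ ℤ.* + suc q ≡ + (p ℕ.* suc q′ ℕ.+ p′ ℕ.* suc q)
    num = cong₂ ℤ._+_ (sym (ℤ.pos-* p (suc q′))) (sym (ℤ.pos-* p′ (suc q)))

  /-homo-* : ∀ p q p′ q′ → + p / suc q * (+ p′ / suc q′) ≡ + (p ℕ.* p′) / (suc q ℕ.* suc q′)
  /-homo-* p q p′ q′ = toℚᵘ-injective (ℚᵘ.≃-trans (toℚᵘ-homo-* (+ p / suc q) (+ p′ / suc q′))
    (ℚᵘ.≃-trans (ℚᵘ.*-cong (toℚᵘ-/ p q) (toℚᵘ-/ p′ q′))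
    (ℚᵘ.≃-trans (ℚᵘ.≃-reflexive (cong (λ z → mkℚᵘ z (ℕ.pred (suc q ℕ.* suc q′))) (sym (ℤ.pos-* p p′))))
      (ℚᵘ.≃-sym (toℚᵘ-/ (p ℕ.* p′) (ℕ.pred (suc q ℕ.* suc q′)))))))

  *-mono-≤ : ∀ {a b x y} → 0ℚ ≤ x → 0ℚ ≤ b → a ≤ b → x ≤ y → a * x ≤ b * y
  *-mono-≤ {a} {b} {x} {y} x≥0 b≥0 a≤b x≤y = ≤-trans
    (*-monoʳ-≤-nonNeg x ⦃ nonNegative x≥0 ⦄ a≤b) (*-monoˡ-≤-nonNeg b ⦃ nonNegative b≥0 ⦄ x≤y)

  *≥0 : ∀ {x y} → 0ℚ ≤ x → 0ℚ ≤ y → 0ℚ ≤ x * y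
  *≥0 {x} {y} x≥0 y≥0 = nonNegative⁻¹ (x * y) ⦃ nonNeg*nonNeg⇒nonNeg x ⦃ nonNegative x≥0 ⦄ y ⦃ nonNegative y≥0 ⦄ ⦄

  *>0 : ∀ {x y} → 0ℚ < x → 0ℚ < y → 0ℚ < x * y
  *>0 {x} {y} x>0 y>0 = positive⁻¹ (x * y) ⦃ pos*pos⇒pos x ⦃ positive x>0 ⦄ y ⦃ positive y>0 ⦄ ⦄

  ≤+ˡ : ∀ {x y} → 0ℚ ≤ x → y ≤ x + y
  ≤+ˡ {x} {y} x≥0 = subst (_≤ x + y) (+-identityˡ y) (+-monoˡ-≤ y x≥0)

  ≤+ʳ : ∀ {x y} → 0ℚ ≤ y → x ≤ x + y
  ≤+ʳ {x} {y} y≥0 = subst (_≤ x + y) (+-identityʳ x) (+-monoʳ-≤ x y≥0)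

  /≥0 : ∀ p q .⦃ _ : ℕ.NonZero q ⦄ → 0ℚ ≤ + p / q
  /≥0 p q = /-mono-≤ 0 1 p q z≤n

  -- Clears the denominators in one step of a telescoping estimate, term times inner sum plus
  -- remaining sum, so that only an inequality between natural numbers is left to check.
  frac-step : ∀ {a x z} A p q p′ q′ P Q
              .⦃ _ : ℕ.NonZero A ⦄ .⦃ _ : ℕ.NonZero q ⦄ .⦃ _ : ℕ.NonZero q′ ⦄ .⦃ _ : ℕ.NonZero Q ⦄ →
              0ℚ ≤ x → a ≤ + 1 / A → x ≤ + p / q → z ≤ + p′ / q′ →
              (p ℕ.* q′ ℕ.+ p′ ℕ.* (A ℕ.* q)) ℕ.* Q ℕ.≤ P ℕ.* (A ℕ.* q ℕ.* q′) →
              a * x + z ≤ + P / Q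
  frac-step {a} {x} {z} (suc A) p (suc q) p′ (suc q′) P Q x≥0 a≤ x≤ z≤ le = begin
    a * x + z                                       ≤⟨ +-mono-≤ (*-mono-≤ x≥0 (/≥0 1 (suc A)) a≤ x≤) z≤ ⟩
    + 1 / suc A * (+ p / suc q) + + p′ / suc q′      ≡⟨ cong (_+ + p′ / suc q′) (/-homo-* 1 A p q) ⟩
    + (1 ℕ.* p) / (suc A ℕ.* suc q) + + p′ / suc q′
      ≡⟨ /-homo-+ (1 ℕ.* p) (ℕ.pred (suc A ℕ.* suc q)) p′ q′ ⟩
    + (1 ℕ.* p ℕ.* suc q′ ℕ.+ p′ ℕ.* (suc A ℕ.* suc q)) / (suc A ℕ.* suc q ℕ.* suc q′)
      ≤⟨ /-mono-≤ (1 ℕ.* p ℕ.* suc q′ ℕ.+ p′ ℕ.* (suc A ℕ.* suc q)) (suc A ℕ.* suc q ℕ.* suc q′) P Q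
           (subst (λ k → (k ℕ.* suc q′ ℕ.+ p′ ℕ.* (suc A ℕ.* suc q)) ℕ.* Q ℕ.≤ _) (sym (ℕ.*-identityˡ p)) le) ⟩
    + P / Q                                         ∎
    where open ≤-Reasoning

  -- The default value 0 of `inv` at 0 keeps this unconditional, so the sums are nonnegative without
  -- any assumption on f.
  inv≥0 : ∀ d → 0ℚ ≤ inv d
  inv≥0 zero    = ≤-refl
  inv≥0 (suc d) = /≥0 1 (suc d)

  inv>0 : ∀ {d} → 1 ℕ.≤ d → 0ℚ < inv d
  inv>0 {suc d} _ = /-mono-< 0 1 1 (suc d) (s≤s z≤n)

  inv≤ : ∀ {d} A .⦃ _ : ℕ.NonZero A ⦄ → A ℕ.≤ d → inv d ≤ + 1 / A
  inv≤ {suc d} A A≤d = /-mono-≤ 1 (suc d) 1 A (ℕ.*-monoʳ-≤ 1 A≤d)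
  inv≤ {zero} (suc A) ()

  -- Sums over intervals of indices.

  Σ≥0 : ∀ {c : ℕ → ℚ} → (∀ i → 0ℚ ≤ c i) → ∀ xs → 0ℚ ≤ Σℚ (map c xs)
  Σ≥0 c≥0 []       = ≤-refl
  Σ≥0 c≥0 (x ∷ xs) = ≤-trans (c≥0 x) (≤+ʳ (Σ≥0 c≥0 xs))

  Σ-mono : ∀ {c d : ℕ → ℚ} → (∀ i → c i ≤ d i) → ∀ xs → Σℚ (map c xs) ≤ Σℚ (map d xs)
  Σ-mono c≤d []       = ≤-refl
  Σ-mono c≤d (x ∷ xs) = +-mono-≤ (c≤d x) (Σ-mono c≤d xs)

  range-empty : ∀ {ℓ n} → n ℕ.< ℓ → range ℓ n ≡ []
  range-empty {ℓ} n<ℓ = cong (λ k → map (ℓ ℕ.+_) (upTo k)) (ℕ.m≤n⇒m∸n≡0 n<ℓ)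

  range-unfold : ∀ {ℓ n} → ℓ ℕ.≤ n → range ℓ n ≡ ℓ ∷ range (suc ℓ) n
  range-unfold {ℓ} {n} ℓ≤n = begin
    map (ℓ ℕ.+_) (upTo (suc n ℕ.∸ ℓ))               ≡⟨ cong (λ k → map (ℓ ℕ.+_) (upTo k)) (ℕ.+-∸-assoc 1 ℓ≤n) ⟩
    ℓ ℕ.+ 0 ∷ map (ℓ ℕ.+_) (applyUpTo suc (n ℕ.∸ ℓ))  ≡⟨ cong₂ _∷_ (ℕ.+-identityʳ ℓ) (map-applyUpTo suc (ℓ ℕ.+_) (n ℕ.∸ ℓ)) ⟩
    ℓ ∷ applyUpTo (λ i → ℓ ℕ.+ suc i) (n ℕ.∸ ℓ)      ≡⟨ cong (ℓ ∷_) (map-upTo (λ i → ℓ ℕ.+ suc i) (n ℕ.∸ ℓ)) ⟨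
    ℓ ∷ map (λ i → ℓ ℕ.+ suc i) (upTo (n ℕ.∸ ℓ))     ≡⟨ cong (ℓ ∷_) (map-cong (ℕ.+-suc ℓ) (upTo (n ℕ.∸ ℓ))) ⟩
    ℓ ∷ range (suc ℓ) n                             ∎
    where open ≡-Reasoning

  Σ-unfold : ∀ (c : ℕ → ℚ) {ℓ n} → ℓ ℕ.≤ n → Σℚ (map c (range ℓ n)) ≡ c ℓ + Σℚ (map c (range (suc ℓ) n))
  Σ-unfold c ℓ≤n = cong (Σℚ ∘ map c) (range-unfold ℓ≤n)

  Σ-empty : ∀ (c : ℕ → ℚ) {ℓ n} → n ℕ.< ℓ → Σℚ (map c (range ℓ n)) ≡ 0ℚ
  Σ-empty c n<ℓ = cong (Σℚ ∘ map c) (range-empty n<ℓ)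

  -- Splitting off the first term as an inequality also covers the empty interval, so later
  -- estimates need no case distinction on ℓ ≤ n.
  Σ-unfold-≤ : ∀ {c : ℕ → ℚ} → (∀ i → 0ℚ ≤ c i) → ∀ ℓ n →
               Σℚ (map c (range ℓ n)) ≤ c ℓ + Σℚ (map c (range (suc ℓ) n))
  Σ-unfold-≤ {c} c≥0 ℓ n with ℓ ℕ.≤? n
  ... | yes ℓ≤n = ≤-reflexive (Σ-unfold c ℓ≤n)
  ... | no  ℓ≰n = ≤-trans (≤-reflexive (Σ-empty c (ℕ.≰⇒> ℓ≰n)))
                    (≤-trans (c≥0 ℓ) (≤+ʳ (Σ≥0 c≥0 (range (suc ℓ) n))))

  Σ-tail-≤ : ∀ {c : ℕ → ℚ} → (∀ i → 0ℚ ≤ c i) → ∀ ℓ n → Σℚ (map c (range (suc ℓ) n)) ≤ Σℚ (map c (range ℓ n))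
  Σ-tail-≤ {c} c≥0 ℓ n with ℓ ℕ.≤? n
  ... | yes ℓ≤n = ≤-trans (≤+ˡ (c≥0 ℓ)) (≤-reflexive (sym (Σ-unfold c ℓ≤n)))
  ... | no  ℓ≰n = ≤-reflexive (trans (Σ-empty c (ℕ.m≤n⇒m≤1+n (ℕ.≰⇒> ℓ≰n))) (sym (Σ-empty c (ℕ.≰⇒> ℓ≰n))))

  -- A sum running from L + m to n is bounded by g m as soon as g telescopes over its terms.
  descend : ∀ (F g c : ℕ → ℚ) L n →
            (∀ m → F m ≤ c m + F (suc m)) →
            (∀ m → n ℕ.< L ℕ.+ m → F m < g m) →
            (∀ m → c m + g (suc m) ≤ g m) →
            ∀ m → F m < g m
  descend F g c L n unfold beyond telescope m =
    go (suc n) m (ℕ.≤-trans (ℕ.m≤n+m (suc n) m) (ℕ.m≤n+m _ L))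
    where
    go : ∀ r m → n ℕ.< L ℕ.+ (m ℕ.+ r) → F m < g m
    go zero    m lt = beyond m (subst (λ k → n ℕ.< L ℕ.+ k) (ℕ.+-identityʳ m) lt)
    go (suc r) m lt = ≤-<-trans (unfold m)
      (<-≤-trans (+-monoʳ-< (c m) (go r (suc m) (subst (λ k → n ℕ.< L ℕ.+ k) (ℕ.+-suc m r) lt))) (telescope m))

  -- Signs and monotonicity of the strict and weak multiple sums.

  module _ (f : Poly) where

    term≥0 : ∀ s i → 0ℚ ≤ term f s i
    term≥0 s i = inv≥0 (eval f i ℕ.^ s)

    term≤ : ∀ s → Admissible f s → ∀ i → term f s (suc i) ≤ + 1 / (suc i ℕ.* suc i)
    term≤ s a i = inv≤ (suc i ℕ.* suc i) (square≤eval^ f s a i)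

    term>0 : 1 ℕ.≤ deg f → ∀ s i → 0ℚ < term f s (suc i)
    term>0 deg≥1 s i = inv>0 (ℕ.m^n>0 (eval f (suc i)) ⦃ ℕ.>-nonZero (eval≥1 f i (isZeroPoly≡false f deg≥1)) ⦄ s)

    term1≡1 : eval f 1 ≡ 1 → ∀ s → term f s 1 ≡ 1ℚ
    term1≡1 f1≡1 s = cong inv (trans (cong (ℕ._^ s) f1≡1) (ℕ.^-zeroˡ s))

    term1≤½ : 2 ℕ.≤ eval f 1 → ∀ s → Admissible f s → term f s 1 ≤ + 1 / 2
    term1≤½ f1≥2 s a = inv≤ 2 (ℕ.≤-trans f1≥2 (v≤v^s (eval f 1) s (ℕ.≤-trans (s≤s z≤n) f1≥2) (s≥1 a)))
      where
      s≥1 : Admissible f s → 1 ℕ.≤ s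
      s≥1 (inj₁ (_ , le)) = le
      s≥1 (inj₂ (_ , le)) = ℕ.≤-trans (s≤s z≤n) le

    Hs≥0 : ∀ n ss ℓ → 0ℚ ≤ Hs f n ss ℓ
    Hs≥0 n []       ℓ = /≥0 1 1
    Hs≥0 n (s ∷ ss) ℓ = Σ≥0 (λ i → *≥0 (term≥0 s i) (Hs≥0 n ss (suc i))) (range ℓ n)

    Hw≥0 : ∀ n ss ℓ → 0ℚ ≤ Hw f n ss ℓ
    Hw≥0 n []       ℓ = /≥0 1 1
    Hw≥0 n (s ∷ ss) ℓ = Σ≥0 (λ i → *≥0 (term≥0 s i) (Hw≥0 n ss i)) (range ℓ n)

    Hs-unfold-≤ : ∀ n s ss ℓ → Hs f n (s ∷ ss) ℓ ≤ term f s ℓ * Hs f n ss (suc ℓ) + Hs f n (s ∷ ss) (suc ℓ)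
    Hs-unfold-≤ n s ss ℓ = Σ-unfold-≤ (λ i → *≥0 (term≥0 s i) (Hs≥0 n ss (suc i))) ℓ n

    Hw-unfold-≤ : ∀ n s ss ℓ → Hw f n (s ∷ ss) ℓ ≤ term f s ℓ * Hw f n ss ℓ + Hw f n (s ∷ ss) (suc ℓ)
    Hw-unfold-≤ n s ss ℓ = Σ-unfold-≤ (λ i → *≥0 (term≥0 s i) (Hw≥0 n ss i)) ℓ n

    Hw-tail-≤ : ∀ n ss ℓ → Hw f n ss (suc ℓ) ≤ Hw f n ss ℓ
    Hw-tail-≤ n []       ℓ = ≤-refl
    Hw-tail-≤ n (s ∷ ss) ℓ = Σ-tail-≤ (λ i → *≥0 (term≥0 s i) (Hw≥0 n ss i)) ℓ n

    Hs≤Hw : ∀ n ss ℓ → Hs f n ss ℓ ≤ Hw f n ss ℓ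
    Hs≤Hw n []       ℓ = ≤-refl
    Hs≤Hw n (s ∷ ss) ℓ = Σ-mono (λ i → *-monoˡ-≤-nonNeg (term f s i) ⦃ nonNegative (term≥0 s i) ⦄
      (≤-trans (Hs≤Hw n ss (suc i)) (Hw-tail-≤ n ss i))) (range ℓ n)

    -- The hypothesis on lengths makes the chain of consecutive indices ℓ + 1, ℓ + 2, ... fit below
    -- n. Its product is positive and the other chains are nonnegative.
    Hs>0 : 1 ℕ.≤ deg f → ∀ n ss ℓ → length ss ℕ.+ ℓ ℕ.≤ n → 0ℚ < Hs f n ss (suc ℓ)
    Hs>0 deg≥1 n []       ℓ le = /-mono-< 0 1 1 1 (s≤s z≤n)
    Hs>0 deg≥1 n (s ∷ ss) ℓ le = subst (0ℚ <_)
      (sym (Σ-unfold (λ i → term f s i * Hs f n ss (suc i)) (ℕ.≤-trans (s≤s (ℕ.m≤n+m ℓ (length ss))) le)))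
      (<-≤-trans (*>0 (term>0 deg≥1 s ℓ) (Hs>0 deg≥1 n ss (suc ℓ) (ℕ.≤-trans (ℕ.≤-reflexive (ℕ.+-suc (length ss) ℓ)) le)))
                 (≤+ʳ (Hs≥0 n (s ∷ ss) (suc (suc ℓ)))))

    -- Telescoping bounds, uniform in n.

    module _ (n : ℕ) where

      private
        W = Hw f n
        S = Hs f n

      Hw-beyond : ∀ s ss p q .⦃ _ : ℕ.NonZero q ⦄ {ℓ} → n ℕ.< ℓ → W (s ∷ ss) ℓ < + suc p / q
      Hw-beyond s ss p q n<ℓ = subst (_< + suc p / q) (sym (Σ-empty (λ i → term f s i * W ss i) n<ℓ))
        (/-mono-< 0 1 (suc p) q (s≤s z≤n))

      Hs-beyond : ∀ s ss p q .⦃ _ : ℕ.NonZero q ⦄ {ℓ} → n ℕ.< ℓ → S (s ∷ ss) ℓ < + suc p / q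
      Hs-beyond s ss p q n<ℓ = subst (_< + suc p / q) (sym (Σ-empty (λ i → term f s i * S ss (suc i)) n<ℓ))
        (/-mono-< 0 1 (suc p) q (s≤s z≤n))

      1<[2+m]/[1+m] : ∀ m → 1ℚ < + (2 ℕ.+ m) / suc m
      1<[2+m]/[1+m] m = /-mono-< 1 1 (2 ℕ.+ m) (suc m) (ℕ.≤-reflexive (lem m))
        where
        lem : ∀ m → suc (1 ℕ.* suc m) ≡ (2 ℕ.+ m) ℕ.* 1
        lem = solve-∀

      -- Mutual induction on the number of indices, with ℓ = 2 + m. If the inner sum is at most ℓ/(ℓ
      -- - 1), the term at ℓ contributes at most 1/(ℓ(ℓ - 1)) = 1/(ℓ - 1) - 1/ℓ, which telescopes.
      -- The bound does not depend on the length of the list.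
      Hw-∷-bound : ∀ {s ss} → All (Admissible f) (s ∷ ss) → ∀ m → W (s ∷ ss) (2 ℕ.+ m) ≤ + 1 / suc m
      Hw-bound   : ∀ {ss} → All (Admissible f) ss → ∀ m → W ss (2 ℕ.+ m) ≤ + (2 ℕ.+ m) / suc m

      Hw-bound []          m = <⇒≤ (1<[2+m]/[1+m] m)
      Hw-bound ds@(_ ∷ _) m = ≤-trans (Hw-∷-bound ds m)
        (/-mono-≤ 1 (suc m) (2 ℕ.+ m) (suc m) (ℕ.*-monoˡ-≤ (suc m) {1} {2 ℕ.+ m} (s≤s z≤n)))

      Hw-∷-bound {s} {ss} (d ∷ ds) m = <⇒≤ (descend
        (λ m → W (s ∷ ss) (2 ℕ.+ m)) (λ m → + 1 / suc m) (λ m → term f s (2 ℕ.+ m) * W ss (2 ℕ.+ m)) 2 n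
        (λ m → Hw-unfold-≤ n s ss (2 ℕ.+ m))
        (λ m lt → Hw-beyond s ss 0 (suc m) lt)
        (λ m → frac-step ((2 ℕ.+ m) ℕ.* (2 ℕ.+ m)) (2 ℕ.+ m) (suc m) 1 (2 ℕ.+ m) 1 (suc m)
          (Hw≥0 n ss (2 ℕ.+ m)) (term≤ s d (suc m)) (Hw-bound ds m) ≤-refl
          (ℕ.≤-reflexive (lem m))) m)
        where
        lem : ∀ m → ((2 ℕ.+ m) ℕ.* (2 ℕ.+ m) ℕ.+ 1 ℕ.* ((2 ℕ.+ m) ℕ.* (2 ℕ.+ m) ℕ.* suc m)) ℕ.* suc m
                  ≡ 1 ℕ.* ((2 ℕ.+ m) ℕ.* (2 ℕ.+ m) ℕ.* suc m ℕ.* (2 ℕ.+ m))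
        lem = solve-∀

      -- With ℓ = 1 + m, 1/ℓ² < 1/(ℓ² - 1/4) = 1/(ℓ - 1/2) - 1/(ℓ + 1/2). This is sharper than 1/(ℓ
      -- - 1) and gives 2/3 from ℓ = 2 and 2/5 from ℓ = 3. For one index `Hs` and `Hw` are the same
      -- expression, so the bound serves both.
      Hw-single-bound : ∀ s → Admissible f s → ∀ m → W (s ∷ []) (1 ℕ.+ m) ≤ + 2 / (1 ℕ.+ 2 ℕ.* m)
      Hw-single-bound s d m = <⇒≤ (descend
        (λ m → W (s ∷ []) (1 ℕ.+ m)) (λ m → + 2 / (1 ℕ.+ 2 ℕ.* m)) (λ m → term f s (1 ℕ.+ m) * 1ℚ) 1 n
        (λ m → Hw-unfold-≤ n s [] (1 ℕ.+ m))
        (λ m lt → Hw-beyond s [] 1 (1 ℕ.+ 2 ℕ.* m) lt)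
        (λ m → frac-step ((1 ℕ.+ m) ℕ.* (1 ℕ.+ m)) 1 1 2 (1 ℕ.+ 2 ℕ.* (1 ℕ.+ m)) 2 (1 ℕ.+ 2 ℕ.* m)
          (/≥0 1 1) (term≤ s d m) ≤-refl ≤-refl
          (ℕ.≤-trans (ℕ.m≤m+n _ 1) (ℕ.≤-reflexive (lem m)))) m)
        where
        lem : ∀ m → (1 ℕ.* (1 ℕ.+ 2 ℕ.* (1 ℕ.+ m)) ℕ.+ 2 ℕ.* ((1 ℕ.+ m) ℕ.* (1 ℕ.+ m) ℕ.* 1)) ℕ.* (1 ℕ.+ 2 ℕ.* m) ℕ.+ 1
                  ≡ 2 ℕ.* ((1 ℕ.+ m) ℕ.* (1 ℕ.+ m) ℕ.* 1 ℕ.* (1 ℕ.+ 2 ℕ.* (1 ℕ.+ m)))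
        lem = solve-∀

      -- With ℓ = 2 + m, the inner sum is at most 1/(ℓ - 1), so the terms are at most 1/(ℓ²(ℓ - 1)).
      -- The differences of 1/(ℓ(ℓ - 1)) are 2/((ℓ - 1)ℓ(ℓ + 1)), and 3/4 is the least factor that
      -- makes them suffice from ℓ = 2 on, with equality at ℓ = 2.
      Hw-double-bound : ∀ {s t ss} → All (Admissible f) (s ∷ t ∷ ss) → ∀ m →
                        W (s ∷ t ∷ ss) (2 ℕ.+ m) ≤ + 3 / (4 ℕ.* ((2 ℕ.+ m) ℕ.* (1 ℕ.+ m)))
      Hw-double-bound {s} {t} {ss} (d ∷ ds) m = <⇒≤ (descend
        (λ m → W (s ∷ t ∷ ss) (2 ℕ.+ m)) (λ m → + 3 / (4 ℕ.* ((2 ℕ.+ m) ℕ.* (1 ℕ.+ m))))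
        (λ m → term f s (2 ℕ.+ m) * W (t ∷ ss) (2 ℕ.+ m)) 2 n
        (λ m → Hw-unfold-≤ n s (t ∷ ss) (2 ℕ.+ m))
        (λ m lt → Hw-beyond s (t ∷ ss) 2 (4 ℕ.* ((2 ℕ.+ m) ℕ.* (1 ℕ.+ m))) lt)
        (λ m → frac-step ((2 ℕ.+ m) ℕ.* (2 ℕ.+ m)) 1 (1 ℕ.+ m) 3 (4 ℕ.* ((3 ℕ.+ m) ℕ.* (2 ℕ.+ m)))
          3 (4 ℕ.* ((2 ℕ.+ m) ℕ.* (1 ℕ.+ m)))
          (Hw≥0 n (t ∷ ss) (2 ℕ.+ m)) (term≤ s d (suc m)) (Hw-∷-bound ds m) ≤-refl
          (ℕ.≤-trans (ℕ.m≤m+n _ (8 ℕ.* m ℕ.* (2 ℕ.+ m) ℕ.* (2 ℕ.+ m) ℕ.* (1 ℕ.+ m))) (ℕ.≤-reflexive (lem m)))) m)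
        where
        lem : ∀ m → (1 ℕ.* (4 ℕ.* ((3 ℕ.+ m) ℕ.* (2 ℕ.+ m))) ℕ.+ 3 ℕ.* ((2 ℕ.+ m) ℕ.* (2 ℕ.+ m) ℕ.* (1 ℕ.+ m)))
                    ℕ.* (4 ℕ.* ((2 ℕ.+ m) ℕ.* (1 ℕ.+ m))) ℕ.+ 8 ℕ.* m ℕ.* (2 ℕ.+ m) ℕ.* (2 ℕ.+ m) ℕ.* (1 ℕ.+ m)
                  ≡ 3 ℕ.* ((2 ℕ.+ m) ℕ.* (2 ℕ.+ m) ℕ.* (1 ℕ.+ m) ℕ.* (4 ℕ.* ((3 ℕ.+ m) ℕ.* (2 ℕ.+ m))))
        lem = solve-∀

      -- In a strict chain the inner sum starts at ℓ + 1, where ℓ = 2 + m, and is at most 1/ℓ. The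
      -- terms are then at most 1/ℓ³ ≤ 1/((ℓ - 1)ℓ(ℓ + 1)), which is half the difference of 1/(ℓ(ℓ -
      -- 1)) at ℓ and ℓ + 1.
      Hs-double-bound : ∀ {s t ss} → All (Admissible f) (s ∷ t ∷ ss) → ∀ m →
                        S (s ∷ t ∷ ss) (2 ℕ.+ m) ≤ + 1 / (2 ℕ.* ((2 ℕ.+ m) ℕ.* (1 ℕ.+ m)))
      Hs-double-bound {s} {t} {ss} (d ∷ ds) m = <⇒≤ (descend
        (λ m → S (s ∷ t ∷ ss) (2 ℕ.+ m)) (λ m → + 1 / (2 ℕ.* ((2 ℕ.+ m) ℕ.* (1 ℕ.+ m))))
        (λ m → term f s (2 ℕ.+ m) * S (t ∷ ss) (3 ℕ.+ m)) 2 n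
        (λ m → Hs-unfold-≤ n s (t ∷ ss) (2 ℕ.+ m))
        (λ m lt → Hs-beyond s (t ∷ ss) 0 (2 ℕ.* ((2 ℕ.+ m) ℕ.* (1 ℕ.+ m))) lt)
        (λ m → frac-step ((2 ℕ.+ m) ℕ.* (2 ℕ.+ m)) 1 (2 ℕ.+ m) 1 (2 ℕ.* ((3 ℕ.+ m) ℕ.* (2 ℕ.+ m)))
          1 (2 ℕ.* ((2 ℕ.+ m) ℕ.* (1 ℕ.+ m)))
          (Hs≥0 n (t ∷ ss) (3 ℕ.+ m)) (term≤ s d (suc m)) (≤-trans (Hs≤Hw n (t ∷ ss) (3 ℕ.+ m)) (Hw-∷-bound ds (suc m))) ≤-refl
          (ℕ.≤-trans (ℕ.m≤m+n _ (4 ℕ.* (2 ℕ.+ m) ℕ.* (2 ℕ.+ m))) (ℕ.≤-reflexive (lem m)))) m)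
        where
        lem : ∀ m → (1 ℕ.* (2 ℕ.* ((3 ℕ.+ m) ℕ.* (2 ℕ.+ m))) ℕ.+ 1 ℕ.* ((2 ℕ.+ m) ℕ.* (2 ℕ.+ m) ℕ.* (2 ℕ.+ m)))
                    ℕ.* (2 ℕ.* ((2 ℕ.+ m) ℕ.* (1 ℕ.+ m))) ℕ.+ 4 ℕ.* (2 ℕ.+ m) ℕ.* (2 ℕ.+ m)
                  ≡ 1 ℕ.* ((2 ℕ.+ m) ℕ.* (2 ℕ.+ m) ℕ.* (2 ℕ.+ m) ℕ.* (2 ℕ.* ((3 ℕ.+ m) ℕ.* (2 ℕ.+ m))))
        lem = solve-∀

      -- Equals Hw f n ss with all indices in {1} ∪ {ℓ, …, n} if the terms at 1 are 1: the chain starts with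
      -- any number of 1's. Unlike Hw alone, it satisfies a telescoping bound that is sharp enough to give 2.
      suffixSum : List ℕ → ℕ → ℚ
      suffixSum []       ℓ = 1ℚ
      suffixSum (s ∷ ss) ℓ = suffixSum ss ℓ + W (s ∷ ss) ℓ

      suffixSum≥0 : ∀ ss ℓ → 0ℚ ≤ suffixSum ss ℓ
      suffixSum≥0 []       ℓ = /≥0 1 1
      suffixSum≥0 (s ∷ ss) ℓ = ≤-trans (suffixSum≥0 ss ℓ) (≤+ʳ (Hw≥0 n (s ∷ ss) ℓ))

      suffixSum-beyond : ∀ ss {ℓ} → n ℕ.< ℓ → suffixSum ss ℓ ≡ 1ℚ
      suffixSum-beyond []       n<ℓ = refl
      suffixSum-beyond (s ∷ ss) n<ℓ =
        cong₂ _+_ (suffixSum-beyond ss n<ℓ) (Σ-empty (λ i → term f s i * W ss i) n<ℓ)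

      -- Split every nonempty suffix of `s ∷ ss` by whether its first index is ℓ. Dropping the heads
      -- of these suffixes yields exactly the suffixes of `ss`, so the parts weighted by w add up to
      -- `w * suffixSum ss ℓ`. The empty suffix contributes 1 on both sides.
      suffixSum-unfold-≤ : ∀ {s ss} → All (Admissible f) (s ∷ ss) → ∀ i → let ℓ = suc i ; w = + 1 / (ℓ ℕ.* ℓ) in
                           suffixSum (s ∷ ss) ℓ ≤ w * suffixSum ss ℓ + suffixSum (s ∷ ss) (suc ℓ)
      suffixSum-unfold-≤ {s} {ss} (d ∷ ds) i = begin
        suffixSum ss ℓ + W (s ∷ ss) ℓ
          ≤⟨ +-monoʳ-≤ (suffixSum ss ℓ) (≤-trans (Hw-unfold-≤ n s ss ℓ) (+-monoˡ-≤ (W (s ∷ ss) (suc ℓ))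
               (*-monoʳ-≤-nonNeg (W ss ℓ) ⦃ nonNegative (Hw≥0 n ss ℓ) ⦄ (term≤ s d i)))) ⟩
        suffixSum ss ℓ + (w * W ss ℓ + W (s ∷ ss) (suc ℓ))
          ≤⟨ rest ds ⟩
        w * suffixSum ss ℓ + suffixSum (s ∷ ss) (suc ℓ) ∎
        where
        open ≤-Reasoning
        open +-*-Solver
        ℓ = suc i
        w = + 1 / (ℓ ℕ.* ℓ)
        rest : ∀ {ss} → All (Admissible f) ss →
               suffixSum ss ℓ + (w * W ss ℓ + W (s ∷ ss) (suc ℓ)) ≤ w * suffixSum ss ℓ + (suffixSum ss (suc ℓ) + W (s ∷ ss) (suc ℓ))
        rest []                  = ≤-reflexive (solve 3 (λ o w h → o :+ (w :* o :+ h) := w :* o :+ (o :+ h)) refl 1ℚ w (W (s ∷ []) (suc ℓ)))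
        rest {t ∷ ts} ds@(_ ∷ _) = ≤-trans (+-monoˡ-≤ _ (suffixSum-unfold-≤ ds i))
          (≤-reflexive (solve 5 (λ w u v x y → (w :* u :+ v) :+ (w :* x :+ y) := w :* (u :+ x) :+ (v :+ y)) refl
            w (suffixSum ts ℓ) (suffixSum (t ∷ ts) (suc ℓ)) (W (t ∷ ts) ℓ) (W (s ∷ t ∷ ts) (suc ℓ))))

      -- With ℓ = 2 + m, the bound ℓ/(ℓ - 1) is the product of (1 - 1/i²)⁻¹ over i ≥ ℓ. It satisfies
      -- the recursion exactly: (1/ℓ²) · ℓ/(ℓ - 1) + (ℓ + 1)/ℓ = ℓ/(ℓ - 1). Strictness comes from
      -- beyond n, where the sum is 1.
      suffixSum-bound : ∀ {ss} → All (Admissible f) ss → ∀ m → suffixSum ss (2 ℕ.+ m) < + (2 ℕ.+ m) / suc m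
      suffixSum-bound []       m = 1<[2+m]/[1+m] m
      suffixSum-bound {s ∷ ss} dds@(d ∷ ds) = descend
        (λ m → suffixSum (s ∷ ss) (2 ℕ.+ m)) (λ m → + (2 ℕ.+ m) / suc m)
        (λ m → + 1 / ((2 ℕ.+ m) ℕ.* (2 ℕ.+ m)) * suffixSum ss (2 ℕ.+ m)) 2 n
        (λ m → suffixSum-unfold-≤ dds (suc m))
        (λ m lt → subst (_< + (2 ℕ.+ m) / suc m) (sym (suffixSum-beyond (s ∷ ss) lt)) (1<[2+m]/[1+m] m))
        (λ m → frac-step ((2 ℕ.+ m) ℕ.* (2 ℕ.+ m)) (2 ℕ.+ m) (suc m) (3 ℕ.+ m) (2 ℕ.+ m) (2 ℕ.+ m) (suc m)
          (suffixSum≥0 ss (2 ℕ.+ m)) ≤-refl (<⇒≤ (suffixSum-bound ds m)) ≤-refl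
          (ℕ.≤-reflexive (lem m)))
        where
        lem : ∀ m → ((2 ℕ.+ m) ℕ.* (2 ℕ.+ m) ℕ.+ (3 ℕ.+ m) ℕ.* ((2 ℕ.+ m) ℕ.* (2 ℕ.+ m) ℕ.* suc m)) ℕ.* suc m
                  ≡ (2 ℕ.+ m) ℕ.* ((2 ℕ.+ m) ℕ.* (2 ℕ.+ m) ℕ.* suc m ℕ.* (2 ℕ.+ m))
        lem = solve-∀

      -- A run of leading 1's contributes a factor at most 1. What follows it is a chain from 2 on,
      -- indexed by a suffix of the list.
      Hw≤suffixSum : ∀ {ss} → All (Admissible f) ss → W ss 1 ≤ suffixSum ss 2
      Hw≤suffixSum []                = ≤-refl
      Hw≤suffixSum {s ∷ ss} (d ∷ ds) = ≤-trans (Hw-unfold-≤ n s ss 1) (+-monoˡ-≤ (W (s ∷ ss) 2)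
        (≤-trans (*-mono-≤ (Hw≥0 n ss 1) (/≥0 1 1) (term≤ s d 0) (Hw≤suffixSum ds)) (≤-reflexive (*-identityˡ (suffixSum ss 2)))))

      Hw<2 : ∀ {ss} → All (Admissible f) ss → W ss 1 < + 2 / 1
      Hw<2 ds = ≤-<-trans (Hw≤suffixSum ds) (suffixSum-bound ds 0)

      Hw>0 : 1 ℕ.≤ deg f → ∀ ss {ℓ} → suc ℓ ℕ.≤ n → 0ℚ < W ss (suc ℓ)
      Hw>0 deg≥1 []       ℓ<n = /-mono-< 0 1 1 1 (s≤s z≤n)
      Hw>0 deg≥1 (s ∷ ss) {ℓ} ℓ<n = subst (0ℚ <_) (sym (Σ-unfold (λ i → term f s i * W ss i) ℓ<n))
        (<-≤-trans (*>0 (term>0 deg≥1 s ℓ) (Hw>0 deg≥1 ss ℓ<n)) (≤+ʳ (Hw≥0 n (s ∷ ss) (suc (suc ℓ)))))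

      module _ (f1≡1 : eval f 1 ≡ 1) where

        Hw-unfold-1 : 1 ℕ.≤ n → ∀ s ss → W (s ∷ ss) 1 ≡ W ss 1 + W (s ∷ ss) 2
        Hw-unfold-1 n≥1 s ss = trans (Σ-unfold (λ i → term f s i * W ss i) n≥1)
          (cong (_+ W (s ∷ ss) 2) (trans (cong (_* W ss 1) (term1≡1 f1≡1 s)) (*-identityˡ (W ss 1))))

        Hw≥1 : 1 ℕ.≤ n → ∀ ss → 1ℚ ≤ W ss 1
        Hw≥1 n≥1 []       = ≤-refl
        Hw≥1 n≥1 (s ∷ ss) = ≤-trans (≤-trans (Hw≥1 n≥1 ss) (≤+ʳ (Hw≥0 n (s ∷ ss) 2)))
          (≤-reflexive (sym (Hw-unfold-1 n≥1 s ss)))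

        -- The chain 1, ..., 1 alone contributes 1, and n ≥ 2 makes the chains starting at 2 add
        -- something positive.
        Hw>1 : 1 ℕ.≤ deg f → 2 ℕ.≤ n → ∀ s ss → 1ℚ < W (s ∷ ss) 1
        Hw>1 deg≥1 n≥2 s ss = subst (1ℚ <_) (sym (Hw-unfold-1 n≥1 s ss))
          (+-mono-≤-< (Hw≥1 n≥1 ss) (Hw>0 deg≥1 (s ∷ ss) n≥2))
          where n≥1 = ℕ.≤-trans (s≤s z≤n) n≥2

      -- 2/3 + 1/4 = 11/12, where 2/3 bounds the chains from 2 on after the first index 1.
      Hs-double<1 : ∀ {s t ss} → All (Admissible f) (s ∷ t ∷ ss) → S (s ∷ t ∷ ss) 1 < 1ℚ
      Hs-double<1 {s} {t} {ss} dds@(d ∷ ds) = ≤-<-trans (Hs-unfold-≤ n s (t ∷ ss) 1)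
        (≤-<-trans (frac-step 1 2 3 1 4 11 12 (Hs≥0 n (t ∷ ss) 2) (term≤ s d 0) (tail ds) (Hs-double-bound dds 0) (ℕ.≤-refl {132}))
          (/-mono-< 11 12 1 1 (ℕ.≤-refl {12})))
        where
        tail : ∀ {t ss} → All (Admissible f) (t ∷ ss) → S (t ∷ ss) 2 ≤ + 2 / 3
        tail {t} {[]}    (d ∷ []) = Hw-single-bound t d 1
        tail {t} {_ ∷ _} ds       = ≤-trans (Hs-double-bound ds 0) (/-mono-≤ 1 4 2 3 (ℕ.m≤m+n 3 5))

      module _ (f1≥2 : 2 ℕ.≤ eval f 1) where

        -- 1/2 · 7/6 + 3/8 = 23/24, with 7/6 = 1/2 + 2/3 in the case k = 2.
        Hw-double≤23/24 : ∀ {s t ss} → All (Admissible f) (s ∷ t ∷ ss) → W (s ∷ t ∷ ss) 1 ≤ + 23 / 24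
        Hw-double≤23/24 {s} {t} {ss} dds@(d ∷ ds) = ≤-trans (Hw-unfold-≤ n s (t ∷ ss) 1)
          (frac-step 2 7 6 3 8 23 24 (Hw≥0 n (t ∷ ss) 1) (term1≤½ f1≥2 s d) (tail ds) (Hw-double-bound dds 0) ℕ.≤-refl)
          where
          tail : ∀ {t ss} → All (Admissible f) (t ∷ ss) → W (t ∷ ss) 1 ≤ + 7 / 6
          tail {t} {[]}    (d ∷ []) = ≤-trans (Hw-unfold-≤ n t [] 1)
            (frac-step 2 1 1 2 3 7 6 (/≥0 1 1) (term1≤½ f1≥2 t d) ≤-refl (Hw-single-bound t d 1) ℕ.≤-refl)
          tail {t} {_ ∷ _} ds       = ≤-trans (Hw-double≤23/24 ds) (/-mono-≤ 23 24 7 6 (ℕ.m≤m+n 138 30))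

        Hw-double<1 : ∀ {s t ss} → All (Admissible f) (s ∷ t ∷ ss) → W (s ∷ t ∷ ss) 1 < 1ℚ
        Hw-double<1 ds = ≤-<-trans (Hw-double≤23/24 ds) (/-mono-< 23 24 1 1 (ℕ.≤-refl {24}))

      -- The comparison terms are 1/ℓ - 1/(ℓ + 1). Strictness holds because the sum beyond n is 0
      -- while 1/ℓ is still positive.
      Hw-single<1-x²+x : ∀ s → (∀ x → suc x ℕ.* suc x ℕ.+ suc x ℕ.≤ eval f (suc x) ℕ.^ s) → W (s ∷ []) 1 < 1ℚ
      Hw-single<1-x²+x s h = descend
        (λ m → W (s ∷ []) (1 ℕ.+ m)) (λ m → + 1 / (1 ℕ.+ m)) (λ m → term f s (1 ℕ.+ m) * 1ℚ) 1 n
        (λ m → Hw-unfold-≤ n s [] (1 ℕ.+ m))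
        (λ m lt → Hw-beyond s [] 0 (1 ℕ.+ m) lt)
        (λ m → frac-step (suc m ℕ.* suc m ℕ.+ suc m) 1 1 1 (2 ℕ.+ m) 1 (1 ℕ.+ m)
          (/≥0 1 1) (inv≤ (suc m ℕ.* suc m ℕ.+ suc m) (h m)) ≤-refl ≤-refl (ℕ.≤-reflexive (lem m))) 0
        where
        lem : ∀ m → (1 ℕ.* (2 ℕ.+ m) ℕ.+ 1 ℕ.* ((suc m ℕ.* suc m ℕ.+ suc m) ℕ.* 1)) ℕ.* (1 ℕ.+ m)
                  ≡ 1 ℕ.* ((suc m ℕ.* suc m ℕ.+ suc m) ℕ.* 1 ℕ.* (2 ℕ.+ m))
        lem = solve-∀

      -- 1/3 + 1/6 + 2/5 = 9/10, where 2/5 bounds the sum of 1/i² over i ≥ 3.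
      Hw-single<1-x²+2 : ∀ s → Admissible f s → (∀ x → suc x ℕ.* suc x ℕ.+ 2 ℕ.≤ eval f (suc x) ℕ.^ s) → W (s ∷ []) 1 < 1ℚ
      Hw-single<1-x²+2 s d h = ≤-<-trans
        (≤-trans (Hw-unfold-≤ n s [] 1)
          (frac-step 3 1 1 17 30 9 10 (/≥0 1 1) (inv≤ 3 (h 0)) ≤-refl
            (≤-trans (Hw-unfold-≤ n s [] 2)
              (frac-step 6 1 1 2 5 17 30 (/≥0 1 1) (inv≤ 6 (h 1)) ≤-refl (Hw-single-bound s d 2) ℕ.≤-refl))
            ℕ.≤-refl))
        (/-mono-< 9 10 1 1 (ℕ.≤-refl {10}))

  -- The partial sums of 1/(x² + 1), and non-integrality in every case.

  Σ-applyUpTo-mono : ∀ (c : ℕ → ℚ) → (∀ i → 0ℚ ≤ c i) → ∀ {m n} → m ℕ.≤ n → Σℚ (applyUpTo c m) ≤ Σℚ (applyUpTo c n)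
  Σ-applyUpTo-mono c c≥0 {n = n} z≤n = subst (λ xs → 0ℚ ≤ Σℚ xs) (map-upTo c n) (Σ≥0 c≥0 (upTo n))
  Σ-applyUpTo-mono c c≥0 (s≤s m≤n)   = +-monoʳ-≤ (c 0) (Σ-applyUpTo-mono (c ∘ suc) (c≥0 ∘ suc) m≤n)

  1/[x²+1] : ℕ → ℚ
  1/[x²+1] i = inv (suc i ℕ.* suc i ℕ.+ 1)

  -- An equality, since these sums are estimated from both sides. The right side no longer involves
  -- f and s, so it can be evaluated at fixed n.
  Hw-single-x²+1 : ∀ f n s → (∀ x → eval f (suc x) ℕ.^ s ≡ suc x ℕ.* suc x ℕ.+ 1) →
                   Hw f n (s ∷ []) 1 ≡ Σℚ (applyUpTo 1/[x²+1] n)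
  Hw-single-x²+1 f n s h = cong Σℚ (begin
    map (λ i → term f s i * 1ℚ) (map suc (upTo n))  ≡⟨ map-∘ (upTo n) ⟨
    map (λ i → term f s (suc i) * 1ℚ) (upTo n)      ≡⟨ map-cong (λ i → trans (*-identityʳ _) (cong inv (h i))) (upTo n) ⟩
    map 1/[x²+1] (upTo n)                           ≡⟨ map-upTo 1/[x²+1] n ⟩
    applyUpTo 1/[x²+1] n                            ∎)
    where open ≡-Reasoning

  between⇒¬IsInteger : ∀ m {q} → + m / 1 < q → q < + suc m / 1 → ¬ IsInteger q
  between⇒¬IsInteger m lo hi (z , refl) = impossible z (strip (+ m) z lo) (strip z (+ suc m) hi)
    where
    strip : ∀ a b → a / 1 < b / 1 → a ℤ.< b
    strip a b lt with ℚᵘ.*<* lt′ ← ℚᵘ.<-respˡ-≃ (toℚᵘ-fromℚᵘ (mkℚᵘ a 0))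
                       (ℚᵘ.<-respʳ-≃ (toℚᵘ-fromℚᵘ (mkℚᵘ b 0)) (toℚᵘ-mono-< lt)) =
      subst₂ ℤ._<_ (ℤ.*-identityʳ a) (ℤ.*-identityʳ b) lt′
    impossible : ∀ z → + m ℤ.< z → ¬ z ℤ.< + suc m
    impossible (+ k) (ℤ.+<+ m<k) (ℤ.+<+ k<1+m) = ℕ.<⇒≱ m<k (ℕ.≤-pred k<1+m)

  Σ₁₂<1 : Σℚ (applyUpTo 1/[x²+1] 12) < 1ℚ
  Σ₁₂<1 = toWitness {a? = Σℚ (applyUpTo 1/[x²+1] 12) <? 1ℚ} tt

  1<Σ₁₃ : 1ℚ < Σℚ (applyUpTo 1/[x²+1] 13)
  1<Σ₁₃ = toWitness {a? = 1ℚ <? Σℚ (applyUpTo 1/[x²+1] 13)} tt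

  Hw-single-¬IsInteger : ∀ f n s → 1 ℕ.≤ n → 1 ℕ.≤ deg f → Admissible f s → 2 ℕ.≤ eval f 1 →
                        ¬ IsInteger (Hw f n (s ∷ []) 1)
  Hw-single-¬IsInteger f n s n≥1 deg≥1 a f1≥2 with eval^-growth f s a f1≥2
  ... | ≥x²+x h = between⇒¬IsInteger 0 (Hw>0 f n deg≥1 (s ∷ []) n≥1) (Hw-single<1-x²+x f n s h)
  ... | ≥x²+2 h = between⇒¬IsInteger 0 (Hw>0 f n deg≥1 (s ∷ []) n≥1) (Hw-single<1-x²+2 f n s a h)
  ... | ≡x²+1 h with n ℕ.≤? 12
  ...   | yes n≤12 = between⇒¬IsInteger 0 (Hw>0 f n deg≥1 (s ∷ []) n≥1)
                       (≤-<-trans (≤-trans (≤-reflexive (Hw-single-x²+1 f n s h))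
                                           (Σ-applyUpTo-mono 1/[x²+1] (λ i → inv≥0 (suc i ℕ.* suc i ℕ.+ 1)) n≤12))
                                  Σ₁₂<1)
  -- From n = 13 on the sum stays above 1 by monotonicity, and the general bound for weak chains
  -- keeps it below 2.
  ...   | no  n≰12 = between⇒¬IsInteger 1
                       (<-≤-trans 1<Σ₁₃
                         (≤-trans (Σ-applyUpTo-mono 1/[x²+1] (λ i → inv≥0 (suc i ℕ.* suc i ℕ.+ 1)) (ℕ.≰⇒> n≰12))
                                  (≤-reflexive (sym (Hw-single-x²+1 f n s h)))))
                       (Hw<2 f n (a ∷ []))

  H-¬IsInteger : ∀ f n ss → 1 ℕ.≤ length ss → length ss ℕ.≤ n → 1 ℕ.≤ deg f → All (Admissible f) ss →
                 ¬ (eval f 1 ≡ 1 × n ≡ 1) →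
                 ¬ IsInteger (Hs f n ss 1) × ¬ IsInteger (Hw f n ss 1)
  H-¬IsInteger f n ss k≥1 k≤n deg≥1 as ¬exc
    with ℕ.m≤n⇒m<n∨m≡n (eval≥1 f 0 (isZeroPoly≡false f deg≥1)) | ss | as
  -- For k = 1 both sums are the same expression, so one proof serves twice. Excluding n = 1 gives
  -- the n ≥ 2 that `Hw>1` requires.
  ... | inj₂ 1≡f1 | s ∷ [] | as = ¬int , ¬int
    where
    ¬int = between⇒¬IsInteger 1
      (Hw>1 f n (sym 1≡f1) deg≥1 (ℕ.≤∧≢⇒< k≤n (λ 1≡n → ¬exc (sym 1≡f1 , sym 1≡n))) s []) (Hw<2 f n as)
  ... | inj₂ 1≡f1 | s ∷ t ∷ ts | as =
    between⇒¬IsInteger 0 (Hs>0 f deg≥1 n (s ∷ t ∷ ts) 0 (subst (ℕ._≤ n) (sym (ℕ.+-identityʳ _)) k≤n)) (Hs-double<1 f n as) ,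
    between⇒¬IsInteger 1 (Hw>1 f n (sym 1≡f1) deg≥1 (ℕ.≤-trans (s≤s (s≤s z≤n)) k≤n) s (t ∷ ts)) (Hw<2 f n as)
  ... | inj₁ f1≥2 | s ∷ [] | a ∷ [] = ¬int , ¬int
    where ¬int = Hw-single-¬IsInteger f n s k≤n deg≥1 a f1≥2
  ... | inj₁ f1≥2 | s ∷ t ∷ ts | as =
    between⇒¬IsInteger 0 (Hs>0 f deg≥1 n (s ∷ t ∷ ts) 0 (subst (ℕ._≤ n) (sym (ℕ.+-identityʳ _)) k≤n))
      (≤-<-trans (Hs≤Hw f n (s ∷ t ∷ ts) 1) w<1) ,
    between⇒¬IsInteger 0 (Hw>0 f n deg≥1 (s ∷ t ∷ ts) (ℕ.≤-trans (s≤s z≤n) k≤n)) w<1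
    where w<1 = Hw-double<1 f n f1≥2 as

-- The exceptional case and the assembly of the theorem.

open PolynomialGrowth
open SumBounds

All-toList : ∀ {P : ℕ → Set} {k} (s : Vec ℕ k) → (∀ j → P (lookup s j)) → All P (Vec.toList s)
All-toList Vec.[]       p = []
All-toList (x Vec.∷ xs) p = p zero ∷ All-toList xs (p ∘ suc)

-- Exponent 0 would make f the constant 1 and its tail zero, whereas positive degree makes the tail
-- nonzero.
monomial-exponent≥1 : ∀ f → 1 ℕ.≤ deg f → eval f 1 ≡ 1 → ∃[ m ] (1 ℕ.≤ m × f ≈P monomial m)
monomial-exponent≥1 f deg≥1 f1≡1 with eval-1≡1⇒monomial f f1≡1
monomial-exponent≥1 f       deg≥1 f1≡1 | suc m , f≈ = suc m , s≤s z≤n , f≈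
monomial-exponent≥1 (a ∷ p) deg≥1 f1≡1 | zero  , f≈ with nz , _ ← deg-∷⁻ a p deg≥1
  with () ← ℕ.≤-trans (eval≥1 p 0 nz) (ℕ.≤-reflexive (eval-cong p [] 1 (f≈ ∘ suc)))

open import Data.Nat using (_≤_)

theorem1p1 : (n k : ℕ) → 1 ≤ k → k ≤ n → (f : Poly) → NonZeroPoly f →
    (s : Vec ℕ k) → (∀ j → 1 ≤ lookup s j) →
    (2 ≤ deg f ⊎ (deg f ≡ 1 × (∀ j → 2 ≤ lookup s j))) →
    ((∃[ m ] (1 ≤ m × f ≈P monomial m) × n ≡ 1 × k ≡ 1) →
    IsInteger (H k f s n) × IsInteger (H* k f s n))
    × (¬ (∃[ m ] (1 ≤ m × f ≈P monomial m) × n ≡ 1 × k ≡ 1) →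
    ¬ IsInteger (H k f s n) × ¬ IsInteger (H* k f s n))
theorem1p1 n k k≥1 k≤n f _ s s≥1 cond = exceptional s , generic
  where
  deg≥1 : 1 ≤ deg f
  deg≥1 = [ ℕ.≤-trans (s≤s z≤n) , (λ { (deg≡1 , _) → ℕ.≤-reflexive (sym deg≡1) }) ]′ cond

  admissible : ∀ j → Admissible f (lookup s j)
  admissible j = Sum.map (_, s≥1 j) (λ { (deg≡1 , s≥2) → deg≡1 , s≥2 j }) cond

  exceptional : ∀ {n k} (s : Vec ℕ k) → (∃[ m ] (1 ≤ m × f ≈P monomial m) × n ≡ 1 × k ≡ 1) →
                IsInteger (H k f s n) × IsInteger (H* k f s n)
  exceptional (x Vec.∷ Vec.[]) (m , (_ , f≈) , refl , refl) = (ℤ.+ 1 , value) , (ℤ.+ 1 , value)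
    where
    value : term f x 1 ℚ.* 1ℚ ℚ.+ 0ℚ ≡ ℤ.+ 1 / 1
    value = cong (λ t → t ℚ.* 1ℚ ℚ.+ 0ℚ) (term1≡1 f (trans (eval-cong f (monomial m) 1 f≈) (eval-monomial-1 m)) x)

  generic : ¬ (∃[ m ] (1 ≤ m × f ≈P monomial m) × n ≡ 1 × k ≡ 1) → ¬ IsInteger (H k f s n) × ¬ IsInteger (H* k f s n)
  generic ¬exc = H-¬IsInteger f n (Vec.toList s)
    (subst (1 ≤_) (sym (length-toList s)) k≥1) (subst (_≤ n) (sym (length-toList s)) k≤n)
    deg≥1 (All-toList s admissible)
    -- If f(1) = 1 and n = 1, then f is a monomial of positive degree and 1 ≤ k ≤ n forces k = 1,
    -- which is the excluded case.
    λ { (f1≡1 , refl) → let m , m≥1 , f≈ = monomial-exponent≥1 f deg≥1 f1≡1 in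
        ¬exc (m , (m≥1 , f≈) , refl , ℕ.≤-antisym k≤n k≥1) }
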